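{- There exists an integer $n_0>0$ such that for all $n\geq n_0$ the following holds: the unique graph on $2n$ vertices with at least $n^2-1$ edges that does not contain two vertices of the same degree joined by a path of length three is the complete bipartite graph $K_{n-1,n+1}$.
   Context: All graphs are finite and simple. A path of length three is a path with three edges (on four distinct vertices); two vertices are joined by a path of length three if they are the two endpoints of such a path. -}

module Defs where

open import Data.Nat using (ℕ; zero; suc; _+_; _<ᵇ_)
open import Data.Bool using (Bool; true; false; _∧_; _xor_; if_then_else_)
open import Data.Fin using (Fin; toℕ) renaming (zero to fz; suc to fs)
open import Data.Product using (_×_; Σ; ∃-syntax; _,_)
open import Relation.Binary.PropositionalEquality using (_≡_; _≢_)
open import Relation.Nullary using (¬_)
open import Function.Bundles using (Bijection; _⤖_)

record Graph (m : ℕ) : Set where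
  field
    adj    : Fin m → Fin m → Bool
    sym    : ∀ i j → adj i j ≡ adj j i
    irrefl : ∀ i → adj i i ≡ false
open Graph public

sumFin : (m : ℕ) → (Fin m → ℕ) → ℕ
sumFin zero    f = 0
sumFin (suc m) f = f fz + sumFin m (λ i → f (fs i))

b2n : Bool → ℕ
b2n true  = 1
b2n false = 0

degree : ∀ {m} → Graph m → Fin m → ℕ
degree {m} G i = sumFin m (λ j → b2n (adj G i j))

edgeCount : ∀ {m} → Graph m → ℕ
edgeCount {m} G =
  sumFin m (λ i → sumFin m (λ j → b2n (adj G i j ∧ (toℕ i <ᵇ toℕ j))))

Adj : ∀ {m} → Graph m → Fin m → Fin m → Set
Adj G i j = adj G i j ≡ true

JoinedByP3 : ∀ {m} → Graph m → Fin m → Fin m → Set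
JoinedByP3 G u v = ∃[ a ] ∃[ b ]
  ( u ≢ a × u ≢ b × u ≢ v × a ≢ b × a ≢ v × b ≢ v
  × Adj G u a × Adj G a b × Adj G b v )

NoEqualDegreeP3 : ∀ {m} → Graph m → Set
NoEqualDegreeP3 G = ∀ u v → degree G u ≡ degree G v → ¬ JoinedByP3 G u v

_≅_ : ∀ {m} → Graph m → Graph m → Set
_≅_ {m} G H = Σ (Fin m ⤖ Fin m) λ σ →
  ∀ i j → adj G i j ≡ adj H (Bijection.to σ i) (Bijection.to σ j)

completeBipartite : (m a : ℕ) → Graph m
completeBipartite m a = record
  { adj = λ i j → (toℕ i <ᵇ a) xor (toℕ j <ᵇ a)
  ; sym = λ i j → xor-comm (toℕ i <ᵇ a) (toℕ j <ᵇ a)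
  ; irrefl = λ i → xor-self (toℕ i <ᵇ a)
  }
  where
  xor-comm : ∀ x y → (x xor y) ≡ (y xor x)
  xor-comm true true = _≡_.refl
  xor-comm true false = _≡_.refl
  xor-comm false true = _≡_.refl
  xor-comm false false = _≡_.refl
  xor-self : ∀ x → (x xor x) ≡ false
  xor-self true = _≡_.refl
  xor-self false = _≡_.refl

{-# OPTIONS --safe #-}
module Submission where

-- Fix a vertex x of maximum degree n + p and put k = n - p, so x has k non-neighbours (x included).
-- If u and v have equal degrees and z ≠ v is a neighbour of u, then N(z) and N(v) can meet only in
-- u, and only if u ~ v; hence d(z) + d(v) ≤ 2n + [u ~ v], the bracket being 1 or 0.
-- In particular two equal-degree neighbours of x have degree at most k + 1, and three such
-- neighbours have degree at most k.
-- * If p < 0 there are too few edges, and if p = 0 at most two vertices have degree below n, so a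
--   path of length three between vertices of degree n is found greedily.
-- * If another vertex of maximum degree is nonadjacent to x, all neighbours of x have degree at
--   most k, so the degrees add up to at most 2k(n + p) = 2n² - 2p².  Hence p = 1 and equality
--   holds throughout, which forces K_{n-1,n+1}.
-- * Otherwise the non-neighbours other than x have degree below n + p.  If x has a
--   neighbour of degree n + p, all its other neighbours have degree at most k + 1; if not, then
--   among the neighbours each degree above k + 1 occurs at most once.  Either way the excesses
--   of their degrees over k add up to at most p(2p - 1) + 3, and all degrees to at most
--   2n² - n + 4, less than 2n² - 2.

open import Defs
open import Data.Nat using (ℕ; _≤_; _<_; _*_; _∸_; _+_)
open import Data.Product using (Σ; _×_)
open import Data.Nat using (zero; suc; z≤n; s≤s; s≤s⁻¹; z<s; _<ᵇ_; _≟_; _<?_)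
open import Data.Nat.Properties hiding (_≟_; _<?_)
open import Data.Nat.Tactic.RingSolver using (solve-∀)
open import Data.Bool as Bool using (Bool; true; false; not; _∧_; _xor_; if_then_else_)
open import Data.Bool.Properties using (not-¬; ∧-conicalˡ; ∧-conicalʳ)
open import Data.Empty using (⊥; ⊥-elim)
open import Data.Fin as Fin using (Fin; toℕ; fromℕ; punchIn) renaming (zero to fz; suc to fs)
open import Data.Fin.Permutation as Perm using (Permutation; insert; _⟨$⟩ʳ_)
open import Data.Fin.Properties as Fin using (any?; toℕ-fromℕ)
open import Data.List using (List; []; _∷_; length)
open import Data.List.Relation.Unary.All as All using (All; []; _∷_)
open import Data.Product using (_,_; ∃; proj₂)
open import Data.Sum using (inj₁; inj₂)
open import Function using (_∘_)
open import Function.Properties.Inverse using (↔⇒⤖)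
open import Relation.Binary using (tri<; tri≈; tri>)
open import Relation.Binary.PropositionalEquality
  using (_≡_; _≢_; refl; trans; cong; cong₂; subst; subst₂; module ≡-Reasoning)
  renaming (sym to ≡-sym)
open import Relation.Nullary using (¬_; Dec; yes; no; does; _×-dec_; contradiction)
open import Relation.Nullary.Decidable using (dec-true; dec-false; ¬?)

private
  variable
    m : ℕ

  [_] : Bool → ℕ
  [_] = b2n

does-sound : ∀ {p} {P : Set p} (P? : Dec P) → does P? ≡ true → P
does-sound (yes p) _ = p

-- Finite sums

sum-cong : {f g : Fin m → ℕ} → (∀ i → f i ≡ g i) → sumFin m f ≡ sumFin m g
sum-cong {zero}  f≡g = refl
sum-cong {suc m} f≡g = cong₂ _+_ (f≡g fz) (sum-cong (λ i → f≡g (fs i)))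

sum-mono : {f g : Fin m → ℕ} → (∀ i → f i ≤ g i) → sumFin m f ≤ sumFin m g
sum-mono {zero}  f≤g = z≤n
sum-mono {suc m} f≤g = +-mono-≤ (f≤g fz) (sum-mono (λ i → f≤g (fs i)))

-- The equality case of `sum-mono`: a strict inequality at one index cannot be compensated at
-- another. It turns an extremal degree sum into exact degrees.
sum-tight : {f g : Fin m → ℕ} → (∀ i → f i ≤ g i) → sumFin m g ≤ sumFin m f → ∀ i → f i ≡ g i
sum-tight {suc m} {f} {g} f≤g Σg≤Σf fz =
  ≤-antisym (f≤g fz)
    (+-cancelʳ-≤ _ (g fz) (f fz) (≤-trans Σg≤Σf (+-monoʳ-≤ (f fz) (sum-mono (λ i → f≤g (fs i))))))
sum-tight {suc m} {f} {g} f≤g Σg≤Σf (fs i) =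
  sum-tight (λ j → f≤g (fs j))
    (+-cancelˡ-≤ (f fz) _ _ (≤-trans (+-monoˡ-≤ _ (f≤g fz)) Σg≤Σf)) i

sum-+ : (f g : Fin m → ℕ) → sumFin m (λ i → f i + g i) ≡ sumFin m f + sumFin m g
sum-+ {zero}  f g = refl
sum-+ {suc m} f g =
  trans (cong (f fz + g fz +_) (sum-+ (f ∘ fs) (g ∘ fs))) (interchange (f fz) (g fz) _ _)
  where
  interchange : ∀ a b c d → (a + b) + (c + d) ≡ (a + c) + (b + d)
  interchange = solve-∀

sum-* : (c : ℕ) (f : Fin m → ℕ) → sumFin m (λ i → c * f i) ≡ c * sumFin m f
sum-* {zero}  c f = ≡-sym (*-zeroʳ c)
sum-* {suc m} c f =
  trans (cong (c * f fz +_) (sum-* c (f ∘ fs))) (≡-sym (*-distribˡ-+ c (f fz) _))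

sum-const : (m c : ℕ) → sumFin m (λ _ → c) ≡ m * c
sum-const zero    c = refl
sum-const (suc m) c = cong (c +_) (sum-const m c)

sum-swap : ∀ {l} (f : Fin l → Fin m → ℕ) →
  sumFin l (λ i → sumFin m (f i)) ≡ sumFin m (λ j → sumFin l (λ i → f i j))
sum-swap {m} {zero}  f = ≡-sym (trans (sum-const m 0) (*-zeroʳ m))
sum-swap {m} {suc l} f =
  trans (cong (sumFin m (f fz) +_) (sum-swap (f ∘ fs)))
        (≡-sym (sum-+ (f fz) (λ j → sumFin l (λ i → f (fs i) j))))

maximum : (f : Fin (suc m) → ℕ) → ∃ λ i → ∀ j → f j ≤ f i
maximum {zero}  f = fz , λ { fz → ≤-refl }
maximum {suc m} f with maximum (f ∘ fs)
... | i , max with ≤-total (f fz) (f (fs i))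
... | inj₁ le = fs i , λ { fz → le ; (fs j) → max j }
... | inj₂ ge = fz , λ { fz → ≤-refl ; (fs j) → ≤-trans (max j) ge }

-- Counting

count : (Fin m → Bool) → ℕ
count P = sumFin _ (b2n ∘ P)

b2n≤1 : ∀ b → [ b ] ≤ 1
b2n≤1 true  = ≤-refl
b2n≤1 false = z≤n

count-point : (a : Fin m) → count (λ i → does (i Fin.≟ a)) ≡ 1
count-point {suc m} fz     = cong suc (trans (sum-const m 0) (*-zeroʳ m))
count-point {suc m} (fs a) = count-point a

count-compl : (P : Fin m → Bool) → count P + count (not ∘ P) ≡ m
count-compl {m} P = begin
  count P + count (not ∘ P)                 ≡⟨ sum-+ (b2n ∘ P) _ ⟨
  sumFin m (λ i → [ P i ] + [ not (P i) ])  ≡⟨ sum-cong (λ i → b2n-compl (P i)) ⟩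
  sumFin m (λ _ → 1)                        ≡⟨ sum-const m 1 ⟩
  m * 1                                     ≡⟨ *-identityʳ m ⟩
  m                                         ∎
  where
  open ≡-Reasoning
  b2n-compl : ∀ b → [ b ] + [ not b ] ≡ 1
  b2n-compl true  = refl
  b2n-compl false = refl

sum-if : (P : Fin m → Bool) (a b : ℕ) →
  sumFin m (λ i → if P i then a else b) ≡ a * count P + b * count (not ∘ P)
sum-if {m} P a b = begin
  sumFin m (λ i → if P i then a else b)           ≡⟨ sum-cong (λ i → split (P i)) ⟩
  sumFin m (λ i → a * [ P i ] + b * [ not (P i) ]) ≡⟨ sum-+ (λ i → a * [ P i ]) _ ⟩
  _                                               ≡⟨ cong₂ _+_ (sum-* a (b2n ∘ P)) (sum-* b (b2n ∘ not ∘ P)) ⟩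
  a * count P + b * count (not ∘ P)               ∎
  where
  open ≡-Reasoning
  true-part : ∀ a b → a ≡ a * 1 + b * 0
  true-part = solve-∀
  false-part : ∀ a b → b ≡ a * 0 + b * 1
  false-part = solve-∀
  split : ∀ p → (if p then a else b) ≡ a * [ p ] + b * [ not p ]
  split true  = true-part a b
  split false = false-part a b

count-positive : (P : Fin m → Bool) → 0 < count P → ∃ λ i → P i ≡ true
count-positive {suc m} P 0<c with P fz in eq
... | true  = fz , eq
... | false with count-positive (P ∘ fs) 0<c
... | i , Pi = fs i , Pi

-- Deleting one element lowers a count by at most 1, so the listed elements can be struck out one by
-- one. Distinct vertices are chosen this way.
∃-outside : (P : Fin m → Bool) (xs : List (Fin m)) → length xs < count P →
  ∃ λ i → P i ≡ true × All (i ≢_) xs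
∃-outside P []       lt with count-positive P lt
... | i , Pi = i , Pi , []
∃-outside {m} P (x ∷ xs) lt with ∃-outside P′ xs (s≤s⁻¹ (≤-trans lt count-P≤))
  where
  P′ : Fin m → Bool
  P′ i = P i ∧ not (does (i Fin.≟ x))
  pointwise : ∀ p q → [ p ] ≤ [ q ] + [ p ∧ not q ]
  pointwise true  true  = s≤s z≤n
  pointwise true  false = s≤s z≤n
  pointwise false q     = z≤n
  count-P≤ : count P ≤ suc (count P′)
  count-P≤ = ≤-trans (sum-mono (λ i → pointwise (P i) (does (i Fin.≟ x))))
    (≤-reflexive (trans (sum-+ {m} _ _) (cong (_+ count P′) (count-point x))))
... | i , P′i , i∉xs = i , ∧-conicalˡ (P i) _ P′i , i≢x ∷ i∉xs
  where
  i≢x : i ≢ x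
  i≢x i≡x = not-¬ (cong not (dec-true (i Fin.≟ x) i≡x)) (∧-conicalʳ (P i) _ P′i)

count≤1 : (P : Fin m → Bool) →
  (∀ i j → P i ≡ true → P j ≡ true → i ≢ j → ⊥) → count P ≤ 1
count≤1 P unique = ≮⇒≥ λ 1<c →
  let i , Pi , _    = ∃-outside P [] (<-trans z<s 1<c)
      j , Pj , j∉is = ∃-outside P (i ∷ []) 1<c
  in unique j i Pj Pi (All.head j∉is)

count≤2 : (P : Fin m → Bool) →
  (∀ i j k → P i ≡ true → P j ≡ true → P k ≡ true → i ≢ j → i ≢ k → j ≢ k → ⊥) →
  count P ≤ 2
count≤2 P no-three = ≮⇒≥ λ 2<c →
  let i , Pi , _     = ∃-outside P [] (<-trans z<s 2<c)
      j , Pj , j∉is  = ∃-outside P (i ∷ []) (<-trans (s≤s z<s) 2<c)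
      k , Pk , k∉jis = ∃-outside P (j ∷ i ∷ []) 2<c
  in no-three k j i Pk Pj Pi (All.head k∉jis) (All.head (All.tail k∉jis)) (All.head j∉is)

-- The bound is 2(1 + (0 + 1 + ⋯ + (M - 1))) with M = 2 + j.
sum-nearly-injective : (f : Fin m → ℕ) →
  count (λ i → does (f i ≟ 1)) ≤ 2 →
  (∀ c → count (λ i → does (f i ≟ suc (suc c))) ≤ 1) →
  ∀ j → (∀ i → f i < suc (suc j)) → 2 * sumFin m f ≤ suc (suc j) * suc j + 2
sum-nearly-injective {m} f ones others j f<M =
  ≤-trans (≤-reflexive (cong (2 *_) (sum-cong λ i → ≡-sym (below-bound i)))) (bound j)
  where
  -- Values from the cutoff M on become 0. Raising M by one lets in only the indices of value M, so
  -- the bound follows by induction on M.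
  below : ℕ → Fin m → ℕ
  below M i = if does (f i <? M) then f i else 0

  below-bound : ∀ i → below (suc (suc j)) i ≡ f i
  below-bound i rewrite dec-true (f i <? suc (suc j)) (f<M i) = refl

  below-suc : ∀ M i → below (suc M) i ≤ below M i + M * [ does (f i ≟ M) ]
  below-suc M i with <-cmp (f i) M
  ... | tri< lt _ _
    rewrite dec-true (f i <? M) lt | dec-true (f i <? suc M) (m<n⇒m<1+n lt) = m≤m+n _ _
  ... | tri≈ _ eq _
    rewrite dec-true (f i <? suc M) (s≤s (≤-reflexive eq)) | dec-true (f i ≟ M) eq =
    ≤-trans (≤-reflexive (trans eq (≡-sym (*-identityʳ M)))) (m≤n+m _ _)
  ... | tri> _ _ gt rewrite dec-false (f i <? suc M) (λ lt → <⇒≱ gt (s≤s⁻¹ lt)) = z≤n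

  total-suc : ∀ M → sumFin m (below (suc M)) ≤ sumFin m (below M) + M * count (λ i → does (f i ≟ M))
  total-suc M = ≤-trans (sum-mono (below-suc M))
    (≤-reflexive (trans (sum-+ (below M) _) (cong (sumFin m (below M) +_) (sum-* M (λ i → [ does (f i ≟ M) ])))))

  total-1 : sumFin m (below 1) ≤ 0
  total-1 = ≤-trans (total-suc 0) (≤-reflexive (trans (+-identityʳ _)
    (trans (sum-const m 0) (*-zeroʳ m))))

  base : ∀ {a b} → a ≤ 0 → b ≤ 2 → 2 * (a + 1 * b) ≤ 4
  base a≤0 b≤2 = *-monoʳ-≤ 2 (+-mono-≤ a≤0 (*-monoʳ-≤ 1 b≤2))

  step : ∀ {a b} j → 2 * a ≤ (2 + j) * (1 + j) + 2 → b ≤ 1 →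
    2 * (a + (2 + j) * b) ≤ (3 + j) * (2 + j) + 2
  step {a} {b} j ha hb = begin
    2 * (a + (2 + j) * b)                     ≡⟨ *-distribˡ-+ 2 a _ ⟩
    2 * a + 2 * ((2 + j) * b)                 ≤⟨ +-mono-≤ ha (*-monoʳ-≤ 2 (*-monoʳ-≤ (2 + j) hb)) ⟩
    (2 + j) * (1 + j) + 2 + 2 * ((2 + j) * 1) ≡⟨ expand j ⟩
    (3 + j) * (2 + j) + 2                     ∎
    where
    open ≤-Reasoning
    expand : ∀ j → (2 + j) * (1 + j) + 2 + 2 * ((2 + j) * 1) ≡ (3 + j) * (2 + j) + 2
    expand = solve-∀

  bound : ∀ j → 2 * sumFin m (below (2 + j)) ≤ (2 + j) * (1 + j) + 2
  bound zero    = ≤-trans (*-monoʳ-≤ 2 (total-suc 1)) (base total-1 ones)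
  bound (suc j) = ≤-trans (*-monoʳ-≤ 2 (total-suc (2 + j))) (step {sumFin m (below (2 + j))} j (bound j) (others j))

-- Moving a subset to an initial segment

below-below : ∀ m a → a ≤ m → count {m} (λ i → toℕ i <ᵇ a) ≡ a
below-below m       zero    _   = trans (sum-const m 0) (*-zeroʳ m)
below-below (suc m) (suc a) a≤m = cong suc (below-below m a (s≤s⁻¹ a≤m))

-- An element of `P` goes to the front and shifts the rest by one; any other goes to the last place
-- and leaves the rest where they are.
sorting : (P : Fin m → Bool) →
  ∃ λ (π : Permutation m m) → ∀ i → P i ≡ (toℕ (π ⟨$⟩ʳ i) <ᵇ count P)
sorting {zero}  P = Perm.id , λ ()
sorting {suc m} P with sorting (P ∘ fs) | P fz in eq
... | π , sorted | true  = insert fz fz π , λ { fz → eq ; (fs i) → sorted i }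
... | π , sorted | false = insert fz (fromℕ m) π , λ
  { fz     → trans eq (≡-sym (trans (cong (_<ᵇ count (P ∘ fs)) (toℕ-fromℕ m)) (≮ᵇ count≤)))
  ; (fs i) → trans (sorted i) (cong (_<ᵇ count (P ∘ fs)) (≡-sym (toℕ-punchIn-fromℕ (π ⟨$⟩ʳ i)))) }
  where
  ≮ᵇ : ∀ {a b} → a ≤ b → (b <ᵇ a) ≡ false
  ≮ᵇ z≤n       = refl
  ≮ᵇ (s≤s a≤b) = ≮ᵇ a≤b
  count≤ : count (P ∘ fs) ≤ m
  count≤ = ≤-trans (m≤m+n _ _) (≤-reflexive (count-compl (P ∘ fs)))
  toℕ-punchIn-fromℕ : ∀ {m} (i : Fin m) → toℕ (punchIn (fromℕ m) i) ≡ toℕ i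
  toℕ-punchIn-fromℕ fz     = refl
  toℕ-punchIn-fromℕ (fs i) = cong suc (toℕ-punchIn-fromℕ i)

-- Graphs

-- After exchanging the order of summation, one copy counts each edge at its larger endpoint and the
-- other at its smaller one.
handshake : (G : Graph m) → edgeCount G + edgeCount G ≡ sumFin m (degree G)
handshake {m} G = begin
  edgeCount G + edgeCount G
    ≡⟨ cong (edgeCount G +_) (sum-swap {m} {m} forward) ⟩
  edgeCount G + sumFin m (λ i → sumFin m (λ j → forward j i))
    ≡⟨ sum-+ (λ i → sumFin m (forward i)) _ ⟨
  sumFin m (λ i → sumFin m (forward i) + sumFin m (λ j → forward j i))
    ≡⟨ sum-cong (λ i → ≡-sym (sum-+ (forward i) _)) ⟩
  sumFin m (λ i → sumFin m (λ j → forward i j + forward j i))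
    ≡⟨ sum-cong (λ i → sum-cong (λ j → oriented i j)) ⟩
  sumFin m (degree G) ∎
  where
  open ≡-Reasoning
  forward : Fin m → Fin m → ℕ
  forward i j = [ adj G i j ∧ (toℕ i <ᵇ toℕ j) ]
  one-order : ∀ a b → a ≢ b → [ a <ᵇ b ] + [ b <ᵇ a ] ≡ 1
  one-order zero    zero    a≢b = contradiction refl a≢b
  one-order zero    (suc b) a≢b = refl
  one-order (suc a) zero    a≢b = refl
  one-order (suc a) (suc b) a≢b = one-order a b (a≢b ∘ cong suc)
  oriented : ∀ i j → forward i j + forward j i ≡ [ adj G i j ]
  oriented i j rewrite Graph.sym G j i with adj G i j in eq
  ... | false = refl
  ... | true  = one-order (toℕ i) (toℕ j) λ i≡j →
    not-¬ (trans (cong (adj G i) (≡-sym (Fin.toℕ-injective {i = i} i≡j))) (irrefl G i)) eq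

-- Complete bipartite graphs with parts of sizes a and b

module _ {m a b : ℕ} (a+b≡m : a + b ≡ m) where

  private
    K : Graph m
    K = completeBipartite m a

    left : Fin m → Bool
    left i = toℕ i <ᵇ a

    count-left : count left ≡ a
    count-left = below-below m a (subst (a ≤_) a+b≡m (m≤m+n a b))

    count-right : count (not ∘ left) ≡ b
    count-right = +-cancelˡ-≡ a _ b
      (trans (cong (_+ count (not ∘ left)) (≡-sym count-left)) (trans (count-compl left) (≡-sym a+b≡m)))

  completeBipartite-degree : ∀ i → degree K i ≡ (if left i then b else a)
  completeBipartite-degree i with left i
  ... | true  = count-right
  ... | false = count-left

  completeBipartite-edgeCount : edgeCount K + edgeCount K ≡ b * a + a * b
  completeBipartite-edgeCount = begin
    edgeCount K + edgeCount K                      ≡⟨ handshake K ⟩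
    sumFin m (degree K)                            ≡⟨ sum-cong completeBipartite-degree ⟩
    sumFin m (λ i → if left i then b else a)       ≡⟨ sum-if left b a ⟩
    b * count left + a * count (not ∘ left)        ≡⟨ cong₂ (λ p q → b * p + a * q) count-left count-right ⟩
    b * a + a * b                                  ∎
    where open ≡-Reasoning

  -- Three edges change sides an odd number of times, so the endpoints lie on opposite sides and
  -- have degrees a and b.
  completeBipartite-noEqualDegreeP3 : a ≢ b → NoEqualDegreeP3 K
  completeBipartite-noEqualDegreeP3 a≢b u v du≡dv (x , y , _ , _ , _ , _ , _ , _ , u~x , x~y , y~v) =
    opposite (left u) (left x) (left y) (left v) u~x x~y y~v
      (trans (≡-sym (completeBipartite-degree u)) (trans du≡dv (completeBipartite-degree v)))
    where
    opposite : ∀ p q r s → p xor q ≡ true → q xor r ≡ true → r xor s ≡ true →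
      (if p then b else a) ≢ (if s then b else a)
    opposite true  false true  false _ _ _ b≡a = a≢b (≡-sym b≡a)
    opposite false true  false true  _ _ _ a≡b = a≢b a≡b

-- Degree bounds from two vertices of equal degree

module EqualDegreeP3Free {m : ℕ} (G : Graph m) (free : NoEqualDegreeP3 G) where

  d : Fin m → ℕ
  d = degree G

  co-d : Fin m → ℕ
  co-d i = count (not ∘ adj G i)

  adj-sym : ∀ {i j} → Adj G i j → Adj G j i
  adj-sym {i} {j} i~j = trans (Graph.sym G j i) i~j

  adj⇒≢ : ∀ {i j} → Adj G i j → i ≢ j
  adj⇒≢ {i} i~i refl = not-¬ (irrefl G i) i~i

  no-P3 : ∀ {u x y v} → d u ≡ d v → u ≢ v → u ≢ y → x ≢ v →
    Adj G u x → Adj G x y → Adj G y v → ⊥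
  no-P3 {u} {x} {y} {v} du≡dv u≢v u≢y x≢v u~x x~y y~v = free u v du≡dv
    (x , y , adj⇒≢ u~x , u≢y , u≢v , adj⇒≢ x~y , x≢v , adj⇒≢ y~v , u~x , x~y , y~v)

  -- A common neighbour w ≠ u of z and v would complete the path u z w v. The vertexwise form is
  -- kept because its equality case yields single adjacencies in `complementary`.
  overlap≤ : ∀ {u v z} → u ≢ v → d u ≡ d v → Adj G u z → z ≢ v →
    ∀ w → [ adj G z w ] + [ adj G v w ] ≤ 1 + [ adj G u v ] * [ does (w Fin.≟ u) ]
  overlap≤ {u} {v} {z} u≢v du≡dv u~z z≢v w with adj G z w in z~w | adj G v w in v~w
  ... | false | q     = ≤-trans (b2n≤1 q) (m≤m+n 1 _)
  ... | true  | false = m≤m+n 1 _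
  ... | true  | true with w Fin.≟ u
  -- At w = u the edge v w is u v itself, so the right-hand side is 2.
  ... | yes refl rewrite adj-sym v~w = ≤-refl
  ... | no  w≢u  = ⊥-elim (no-P3 du≡dv u≢v (w≢u ∘ ≡-sym) z≢v u~z z~w (adj-sym v~w))

  -- N(z) and N(v) meet at most in u, since a common neighbour w gives the path u z w v.
  equal-degree-bound : ∀ {u v z} → u ≢ v → d u ≡ d v → Adj G u z → z ≢ v →
    d z + d v ≤ m + [ adj G u v ]
  equal-degree-bound {u} {v} {z} u≢v du≡dv u~z z≢v = begin
    d z + d v                                       ≡⟨ sum-+ (b2n ∘ adj G z) (b2n ∘ adj G v) ⟨
    sumFin m (λ w → [ adj G z w ] + [ adj G v w ])  ≤⟨ sum-mono (overlap≤ u≢v du≡dv u~z z≢v) ⟩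
    sumFin m (λ w → 1 + [ adj G u v ] * at-u w)     ≡⟨ sum-+ (λ _ → 1) (λ w → [ adj G u v ] * at-u w) ⟩
    sumFin m (λ _ → 1) + sumFin m (λ w → [ adj G u v ] * at-u w)
      ≡⟨ cong₂ _+_ (sum-const m 1) (sum-* [ adj G u v ] at-u) ⟩
    m * 1 + [ adj G u v ] * sumFin m at-u           ≡⟨ cong (λ c → m * 1 + [ adj G u v ] * c) (count-point u) ⟩
    m * 1 + [ adj G u v ] * 1                       ≡⟨ cong₂ _+_ (*-identityʳ m) (*-identityʳ _) ⟩
    m + [ adj G u v ]                               ∎
    where
    open ≤-Reasoning
    at-u : Fin m → ℕ
    at-u w = [ does (w Fin.≟ u) ]

  -- Here z ≠ v is automatic, as z is adjacent to u and v is not.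
  nonadjacent-bound : ∀ {u v z} → u ≢ v → d u ≡ d v → adj G u v ≡ false → Adj G u z →
    d z + d v ≤ m
  nonadjacent-bound {u} {v} {z} u≢v du≡dv u≁v u~z =
    subst (d z + d v ≤_) (trans (cong (λ q → m + [ q ]) u≁v) (+-identityʳ m))
      (equal-degree-bound u≢v du≡dv u~z λ { refl → not-¬ u≁v u~z })

  adjacent-bound : ∀ {u v z} → u ≢ v → d u ≡ d v → Adj G u z → z ≢ v → d z + d v ≤ m + 1
  adjacent-bound {u} {v} u≢v du≡dv u~z z≢v =
    ≤-trans (equal-degree-bound u≢v du≡dv u~z z≢v) (+-monoʳ-≤ m (b2n≤1 (adj G u v)))

  -- x plays the role of z in `adjacent-bound` for the pair y, y′.
  twin-neighbours : ∀ {x y y′} → y ≢ y′ → d y ≡ d y′ → Adj G x y → Adj G x y′ →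
    d x + d y ≤ m + 1
  twin-neighbours {x} y≢y′ dy≡dy′ x~y x~y′ =
    subst (λ c → d x + c ≤ m + 1) (≡-sym dy≡dy′)
      (adjacent-bound y≢y′ dy≡dy′ (adj-sym x~y) (adj⇒≢ x~y′))

  -- If two of three equal-degree neighbours are nonadjacent the bound follows from those two;
  -- otherwise y y″ x y′ is a forbidden path.
  triple-neighbours : ∀ {x y y′ y″} → y ≢ y′ → y ≢ y″ → y′ ≢ y″ → d y ≡ d y′ → d y ≡ d y″ →
    Adj G x y → Adj G x y′ → Adj G x y″ → d x + d y ≤ m
  triple-neighbours {x} {y} {y′} {y″} y≢y′ y≢y″ y′≢y″ dy≡dy′ dy≡dy″ x~y x~y′ x~y″
    with adj G y y″ in y~y″
  ... | false = subst (λ c → d x + c ≤ m) (≡-sym dy≡dy″)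
                  (nonadjacent-bound y≢y″ dy≡dy″ y~y″ (adj-sym x~y))
  ... | true  = ⊥-elim (no-P3 dy≡dy′ y≢y′ (adj⇒≢ x~y ∘ ≡-sym) (y′≢y″ ∘ ≡-sym)
                  y~y″ (adj-sym x~y″) x~y′)

  -- Maximum degree n

  module NearRegular {n : ℕ} (m≡2n : m ≡ n + n) (5≤n : 5 ≤ n) (d≤n : ∀ v → d v ≤ n)
                     (dense : n * n + n * n ≤ sumFin m d + 2) where

    full : Fin m → Fin m → Bool
    full x v = adj G x v ∧ does (d v ≟ n)

    full-sound : ∀ {x v} → full x v ≡ true → Adj G x v × d v ≡ n
    full-sound {x} {v} fv =
      ∧-conicalˡ (adj G x v) _ fv , does-sound (d v ≟ n) (∧-conicalʳ (adj G x v) _ fv)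

    -- The deficits n - d v add up to at most 2, so at most two of the n ≥ 5 neighbours of x have
    -- degree below n.
    full-many : ∀ {x} → d x ≡ n → 2 < count (full x)
    full-many {x} dx≡n = +-cancelʳ-≤ 2 3 _ (≤-trans 5≤n (+-cancelʳ-≤ (n * n + n * n) _ _ (begin
      n + (n * n + n * n)               ≤⟨ +-monoʳ-≤ n dense ⟩
      n + (sumFin m d + 2)              ≡⟨ cong (_+ (sumFin m d + 2)) dx≡n ⟨
      d x + (sumFin m d + 2)            ≡⟨ +-assoc (d x) _ 2 ⟨
      d x + sumFin m d + 2              ≡⟨ cong (_+ 2) (sum-+ (b2n ∘ adj G x) d) ⟨
      sumFin m (λ v → [ adj G x v ] + d v) + 2
        ≤⟨ +-monoˡ-≤ 2 (sum-mono pointwise) ⟩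
      sumFin m (λ v → [ full x v ] + n) + 2
        ≡⟨ cong (_+ 2) (trans (sum-+ (b2n ∘ full x) (λ _ → n))
             (cong (count (full x) +_) (trans (sum-const m n) (cong (_* n) m≡2n)))) ⟩
      count (full x) + (n + n) * n + 2  ≡⟨ rearrange (count (full x)) n ⟩
      count (full x) + 2 + (n * n + n * n) ∎)))
      where
      open ≤-Reasoning
      rearrange : ∀ c n → c + (n + n) * n + 2 ≡ c + 2 + (n * n + n * n)
      rearrange = solve-∀
      pointwise : ∀ v → [ adj G x v ] + d v ≤ [ full x v ] + n
      pointwise v with adj G x v
      ... | false = d≤n v
      ... | true with d v ≟ n
      ... | yes dv≡n rewrite dec-true (d v ≟ n) dv≡n = s≤s (d≤n v)
      ... | no  dv≢n = ≤-trans (≤∧≢⇒< (d≤n v) dv≢n) (m≤n+m n _)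

    -- The forbidden path is y′ x y z, with all four degrees equal to n. Three candidates for z
    -- suffice, since it has to avoid x and y′.
    impossible : ∀ {x} → d x ≡ n → ⊥
    impossible {x} dx≡n =
      let y , xy , _       = ∃-outside (full x) [] (<-trans z<s (<-trans (s≤s z<s) (full-many dx≡n)))
          x~y , dy≡n       = full-sound {x} {y} xy
          y′ , xy′ , y′∉   = ∃-outside (full x) (y ∷ []) (<-trans (s≤s z<s) (full-many dx≡n))
          x~y′ , dy′≡n     = full-sound {x} {y′} xy′
          z , yz , z∉      = ∃-outside (full y) (x ∷ y′ ∷ []) (full-many dy≡n)
          y~z , dz≡n       = full-sound {y} {z} yz
      in no-P3 (trans dy′≡n (≡-sym dz≡n)) (All.head (All.tail z∉) ∘ ≡-sym) (All.head y′∉)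
           (All.head z∉ ∘ ≡-sym) (adj-sym x~y′) x~y y~z

  -- Maximum degree above n

  -- Here suc p is the excess of the maximum degree over n.
  module Excess {n k p : ℕ} (m≡2n : m ≡ n + n) (n≡k+1+p : n ≡ k + suc p) {x : Fin m}
                (co-dx≡k : co-d x ≡ k) (d≤dx : ∀ v → d v ≤ d x) where

    dx≡ : d x ≡ k + (suc p + suc p)
    dx≡ = +-cancelʳ-≡ k _ _ (begin
      d x + k                       ≡⟨ cong (d x +_) co-dx≡k ⟨
      d x + co-d x                  ≡⟨ count-compl (adj G x) ⟩
      m                             ≡⟨ trans m≡2n (cong₂ _+_ n≡k+1+p n≡k+1+p) ⟩
      k + suc p + (k + suc p)       ≡⟨ rearrange k p ⟩
      k + (suc p + suc p) + k       ∎)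
      where
      open ≡-Reasoning
      rearrange : ∀ k p → k + suc p + (k + suc p) ≡ k + (suc p + suc p) + k
      rearrange = solve-∀

    m≡ : m ≡ d x + k
    m≡ = ≡-sym (trans (cong (d x +_) (≡-sym co-dx≡k)) (count-compl (adj G x)))

    -- Truncated subtraction turns a deficit into 0, which is safe because only upper bounds on
    -- degrees are drawn from it.
    excess : Fin m → ℕ
    excess v = if adj G x v then d v ∸ k else 0

    -- A positive excess rules out both sources of a default 0, so vertices sharing one are
    -- neighbours of x of equal degree.
    excess-suc : ∀ {v c} → excess v ≡ suc c → Adj G x v × d v ≡ k + suc c
    excess-suc {v} ev with adj G x v
    ... | true = refl , trans (≡-sym (m+[n∸m]≡n {k} (<⇒≤ (m∸n≢0⇒n<m λ e → 1+n≢0 (trans (≡-sym ev) e)))))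
                              (cong (k +_) ev)

    -- Three neighbours of degree k + 1 would violate `triple-neighbours`, since m = d x + k.
    ones : count (λ v → does (excess v ≟ 1)) ≤ 2
    ones = count≤2 _ λ y y′ y″ ey ey′ ey″ y≢y′ y≢y″ y′≢y″ →
      let x~y  , dy  = excess-suc {y} (does-sound (excess y ≟ _) ey)
          x~y′ , dy′ = excess-suc {y′} (does-sound (excess y′ ≟ _) ey′)
          x~y″ , dy″ = excess-suc {y″} (does-sound (excess y″ ≟ _) ey″)
      in too-big (subst₂ (λ a b → d x + a ≤ b) dy m≡
           (triple-neighbours y≢y′ y≢y″ y′≢y″ (trans dy (≡-sym dy′)) (trans dy (≡-sym dy″)) x~y x~y′ x~y″))
      where
      too-big : ¬ (d x + (k + 1) ≤ d x + k)
      too-big le = m+1+n≰m k (+-cancelˡ-≤ (d x) _ _ le)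

    -- Two neighbours of the same degree at least k + 2 would violate `twin-neighbours`.
    others : ∀ c → count (λ v → does (excess v ≟ suc (suc c))) ≤ 1
    others c = count≤1 _ λ y y′ ey ey′ y≢y′ →
      let x~y  , dy  = excess-suc {y} (does-sound (excess y ≟ _) ey)
          x~y′ , dy′ = excess-suc {y′} (does-sound (excess y′ ≟ _) ey′)
      in too-big (subst₂ (λ a b → d x + a ≤ b + 1) dy m≡
           (twin-neighbours y≢y′ (trans dy (≡-sym dy′)) x~y x~y′))
      where
      too-big : ¬ (d x + (k + (2 + c)) ≤ d x + k + 1)
      too-big le = 1+n≰n (≤-trans (s≤s (s≤s z≤n))
        (+-cancelˡ-≤ (d x + k) (2 + c) 1 (subst (_≤ d x + k + 1) (≡-sym (+-assoc (d x) k (2 + c))) le)))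

    -- The largest possible excess, 2p + 2, would need degree d x. So all excesses lie below M = 2p
    -- + 2 in `sum-nearly-injective`.
    excess-unique-max : (∀ v → Adj G x v → d v ≢ d x) →
      sumFin m excess ≤ (1 + p) * (1 + (p + p)) + 3
    excess-unique-max unique = *-cancelˡ-≤ 2
      (≤-trans (sum-nearly-injective excess ones others (p + p) excess<)
        -- The added 4 raises the final constant from 1 to 3, giving the same bound as
        -- `excess-adjacent-max`, whose estimate 2p + 4 attains it at p = 0.
        (≤-trans (m≤m+n _ 4) (≤-reflexive (expand p))))
      where
      expand : ∀ p → (2 + (p + p)) * (1 + (p + p)) + 2 + 4 ≡ 2 * ((1 + p) * (1 + (p + p)) + 3)
      expand = solve-∀
      excess< : ∀ v → excess v < 2 + (p + p)
      excess< v with adj G x v in x~v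
      ... | false = s≤s z≤n
      ... | true  = m<n+o⇒m∸n<o (d v) k (subst (d v <_)
                      (trans dx≡ (cong (λ c → k + suc c) (+-suc p p)))
                      (≤∧≢⇒< (d≤dx v) (unique v x~v)))

    -- Now x and y are the pair of equal degree, so every other neighbour of x has excess at most 1.
    -- This leaves 2(p + 1) for y and at most two ones.
    excess-adjacent-max : ∀ {y} → Adj G x y → d y ≡ d x →
      sumFin m excess ≤ (1 + p) * (1 + (p + p)) + 3
    excess-adjacent-max {y} x~y dy≡dx = begin
      sumFin m excess                                         ≤⟨ sum-mono pointwise ⟩
      sumFin m (λ v → (suc p + suc p) * at-y v + one v)       ≡⟨ sum-+ (λ v → (suc p + suc p) * at-y v) one ⟩
      sumFin m (λ v → (suc p + suc p) * at-y v) + sumFin m one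
        ≡⟨ cong (_+ sumFin m one) (trans (sum-* (suc p + suc p) at-y)
             (cong ((suc p + suc p) *_) (count-point y))) ⟩
      (suc p + suc p) * 1 + sumFin m one                      ≤⟨ +-monoʳ-≤ ((suc p + suc p) * 1) ones ⟩
      (suc p + suc p) * 1 + 2                                 ≤⟨ m≤m+n _ (p + 2 * p * p) ⟩
      (suc p + suc p) * 1 + 2 + (p + 2 * p * p)               ≡⟨ expand p ⟩
      (1 + p) * (1 + (p + p)) + 3                             ∎
      where
      open ≤-Reasoning
      expand : ∀ p → (suc p + suc p) * 1 + 2 + (p + 2 * p * p) ≡ (1 + p) * (1 + (p + p)) + 3
      expand = solve-∀
      at-y one : Fin m → ℕ
      at-y v = [ does (v Fin.≟ y) ]
      one v = [ does (excess v ≟ 1) ]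
      bound : ∀ v → v ≢ y → Adj G x v → d v ∸ k ≤ 1
      bound v v≢y x~v = m≤n+o⇒m∸n≤o (d v) k (+-cancelʳ-≤ (d x) (d v) (k + 1)
        (subst₂ (λ a b → d v + a ≤ b) dy≡dx (trans (cong (_+ 1) m≡) (rearrange (d x) k))
          (adjacent-bound (adj⇒≢ x~y) (≡-sym dy≡dx) x~v v≢y)))
        where
        rearrange : ∀ a k → a + k + 1 ≡ k + 1 + a
        rearrange = solve-∀
      ≤1⇒≤one : ∀ v → excess v ≤ 1 → excess v ≤ one v
      ≤1⇒≤one v e≤1 with excess v
      ... | zero        = z≤n
      ... | suc zero    = ≤-refl
      ≤1⇒≤one v (s≤s ()) | suc (suc _)
      2p≤ : d x ∸ k ≤ (suc p + suc p) * 1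
      2p≤ = ≤-reflexive (trans (trans (cong (_∸ k) dx≡) (m+n∸m≡n k _)) (≡-sym (*-identityʳ _)))
      excess≤ : ∀ v → excess v ≤ d x ∸ k
      excess≤ v with adj G x v
      ... | false = z≤n
      ... | true  = ∸-monoˡ-≤ k (d≤dx v)
      excess-off : ∀ v → v ≢ y → excess v ≤ 1
      excess-off v v≢y with adj G x v in x~v
      ... | false = z≤n
      ... | true  = bound v v≢y x~v
      pointwise : ∀ v → excess v ≤ (suc p + suc p) * at-y v + one v
      pointwise v with v Fin.≟ y
      ... | yes _   = ≤-trans (≤-trans (excess≤ v) 2p≤) (m≤m+n _ (one v))
      ... | no  v≢y = ≤-trans (≤1⇒≤one v (excess-off v v≢y)) (m≤n+m (one v) _)

    -- The baseline is k on neighbours and D on non-neighbours. Neighbours are corrected by their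
    -- excess, and x, the one non-neighbour of degree `suc D`, by 1.
    sum-bound : ∀ {D} → d x ≡ suc D → (∀ v → v ≢ x → adj G x v ≡ false → d v ≤ D) →
      sumFin m d ≤ (k * suc D + D * k) + (sumFin m excess + 1)
    sum-bound {D} dx≡1+D d≤D = begin
      sumFin m d ≤⟨ sum-mono pointwise ⟩
      sumFin m (λ v → (if adj G x v then k else D) + (excess v + at-x v))
        ≡⟨ sum-+ (λ v → if adj G x v then k else D) (λ v → excess v + at-x v) ⟩
      sumFin m (λ v → if adj G x v then k else D) + sumFin m (λ v → excess v + at-x v)
        ≡⟨ cong₂ _+_ (sum-if (adj G x) k D) (sum-+ excess at-x) ⟩
      (k * d x + D * co-d x) + (sumFin m excess + sumFin m at-x)
        ≡⟨ cong₂ _+_ (cong₂ (λ a b → k * a + D * b) dx≡1+D co-dx≡k)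
                     (cong (sumFin m excess +_) (count-point x)) ⟩
      (k * suc D + D * k) + (sumFin m excess + 1) ∎
      where
      open ≤-Reasoning
      at-x : Fin m → ℕ
      at-x v = [ does (v Fin.≟ x) ]
      pointwise : ∀ v → d v ≤ (if adj G x v then k else D) + (excess v + at-x v)
      pointwise v with adj G x v in x~v
      ... | true  = ≤-trans (m≤n+m∸n (d v) k) (+-monoʳ-≤ k (m≤m+n (d v ∸ k) _))
      ... | false with v Fin.≟ x
      ... | yes refl = ≤-reflexive (trans dx≡1+D (+-comm 1 D))
      ... | no  v≢x  = ≤-trans (d≤D v v≢x x~v) (m≤m+n D 0)

    -- The degrees add up to at most 2n² - n + 4 but to at least 2n² - 2, so n ≤ 6.
    excess-impossible : 7 ≤ n → n * n + n * n ≤ sumFin m d + 2 →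
      (∀ v → v ≢ x → adj G x v ≡ false → d v ≢ d x) →
      sumFin m excess ≤ (1 + p) * (1 + (p + p)) + 3 → ⊥
    excess-impossible 7≤n dense d≢ E≤ = 1+n≰n (≤-trans (subst (7 ≤_) n≡k+1+p 7≤n)
      (+-cancelˡ-≤ C (k + suc p) 6 (begin
        C + (k + suc p)                              ≡⟨ lower k p ⟨
        (k + suc p) * (k + suc p) + (k + suc p) * (k + suc p) ≡⟨ cong (λ c → c * c + c * c) n≡k+1+p ⟨
        n * n + n * n                                ≤⟨ dense ⟩
        sumFin m d + 2                               ≤⟨ +-monoˡ-≤ 2 (sum-bound (trans dx≡ (+-suc k _)) d≤D) ⟩
        k * suc D + D * k + (sumFin m excess + 1) + 2
          ≤⟨ +-monoˡ-≤ 2 (+-monoʳ-≤ (k * suc D + D * k) (+-monoˡ-≤ 1 E≤)) ⟩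
        k * suc D + D * k + ((1 + p) * (1 + (p + p)) + 3 + 1) + 2 ≡⟨ upper k p ⟩
        C + 6                                        ∎)))
      where
      open ≤-Reasoning
      D C : ℕ
      D = k + (p + suc p)
      -- This is 2n² - n for n = k + p + 1, expanded to avoid subtraction.
      C = 2 * k * k + 4 * k * p + 3 * k + 2 * p * p + 3 * p + 1
      d≤D : ∀ v → v ≢ x → adj G x v ≡ false → d v ≤ D
      d≤D v v≢x x≁v = s≤s⁻¹ (subst (d v <_) (trans dx≡ (+-suc k _)) (≤∧≢⇒< (d≤dx v) (d≢ v v≢x x≁v)))
      lower : ∀ k p → (k + suc p) * (k + suc p) + (k + suc p) * (k + suc p) ≡
        2 * k * k + 4 * k * p + 3 * k + 2 * p * p + 3 * p + 1 + (k + suc p)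
      lower = solve-∀
      upper : ∀ k p → k * suc (k + (p + suc p)) + (k + (p + suc p)) * k
          + ((1 + p) * (1 + (p + p)) + 3 + 1) + 2 ≡
        2 * k * k + 4 * k * p + 3 * k + 2 * p * p + 3 * p + 1 + 6
      upper = solve-∀

  -- Two nonadjacent vertices of maximum degree

  module NonadjacentMax {x v : Fin m} (v≢x : v ≢ x) (x≁v : adj G x v ≡ false) (dv≡dx : d v ≡ d x)
                        (d≤dx : ∀ w → d w ≤ d x) where

    -- These are the degrees in the complete bipartite graph between the neighbours and the
    -- non-neighbours of x.
    profile : Fin m → ℕ
    profile i = if adj G x i then co-d x else d x

    d≤profile : ∀ i → d i ≤ profile i
    d≤profile i with adj G x i in x~i
    ... | false = d≤dx i
    ... | true  = +-cancelʳ-≤ (d x) (d i) (co-d x)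
      (subst₂ (λ a b → d i + a ≤ b) dv≡dx
        (trans (≡-sym (count-compl (adj G x))) (+-comm (d x) (co-d x)))
        (nonadjacent-bound (v≢x ∘ ≡-sym) (≡-sym dv≡dx) x≁v x~i))

    sum-profile : sumFin m profile ≡ co-d x * d x + d x * co-d x
    sum-profile = sum-if (adj G x) (co-d x) (d x)

    module Tight (tight : sumFin m profile ≤ sumFin m d) (0<dx : 0 < d x) where

      d≡profile : ∀ i → d i ≡ profile i
      d≡profile = sum-tight d≤profile tight

      nonneighbour-degree : ∀ {w} → adj G x w ≡ false → d w ≡ d x
      nonneighbour-degree {w} x≁w = trans (d≡profile w) (cong (if_then co-d x else d x) x≁w)

      neighbour-degree : ∀ {z} → Adj G x z → d z ≡ co-d x
      neighbour-degree {z} x~z = trans (d≡profile z) (cong (if_then co-d x else d x) x~z)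

      -- As x and w are nonadjacent of equal degree, `overlap≤` makes the neighbourhoods of z and w
      -- disjoint. Their sizes add up to m, so they partition the vertices.
      complementary : ∀ {z w} → Adj G x z → w ≢ x → adj G x w ≡ false →
        ∀ i → [ adj G z i ] + [ adj G w i ] ≡ 1
      complementary {z} {w} x~z w≢x x≁w = sum-tight disjoint (≤-reflexive (begin
        sumFin m (λ _ → 1)                              ≡⟨ trans (sum-const m 1) (*-identityʳ m) ⟩
        m                                               ≡⟨ count-compl (adj G x) ⟨
        d x + co-d x                                    ≡⟨ +-comm (d x) (co-d x) ⟩
        co-d x + d x                                    ≡⟨ cong₂ _+_ (neighbour-degree x~z) (nonneighbour-degree x≁w) ⟨
        d z + d w                                       ≡⟨ sum-+ (b2n ∘ adj G z) (b2n ∘ adj G w) ⟨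
        sumFin m (λ i → [ adj G z i ] + [ adj G w i ])  ∎))
        where
        open ≡-Reasoning
        disjoint : ∀ i → [ adj G z i ] + [ adj G w i ] ≤ 1
        disjoint i = subst (λ q → [ adj G z i ] + [ adj G w i ] ≤ 1 + [ q ] * [ does (i Fin.≟ x) ]) x≁w
          (overlap≤ (w≢x ∘ ≡-sym) (≡-sym (nonneighbour-degree x≁w)) x~z
            (λ { refl → not-¬ x≁w x~z }) i)

      -- Since w is not its own neighbour, `complementary` read at w puts it next to z.
      cross : ∀ {z w} → Adj G x z → adj G x w ≡ false → Adj G z w
      cross {z} {w} x~z x≁w with w Fin.≟ x
      ... | yes refl = adj-sym x~z
      ... | no  w≢x  = first-true (adj G z w)
        (subst (λ q → [ adj G z w ] + [ q ] ≡ 1) (irrefl G w) (complementary x~z w≢x x≁w w))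
        where
        first-true : ∀ p → [ p ] + 0 ≡ 1 → p ≡ true
        first-true true _ = refl

      -- By `cross`, z′ is adjacent to v, so `complementary` for z and v excludes it from the
      -- neighbourhood of z.
      neighbours-independent : ∀ {z z′} → Adj G x z → Adj G x z′ → adj G z z′ ≡ false
      neighbours-independent {z} {z′} x~z x~z′ = first-false (adj G z z′)
        (subst (λ q → [ adj G z z′ ] + [ q ] ≡ 1) (adj-sym (cross x~z′ x≁v))
          (complementary x~z v≢x x≁v z′))
        where
        first-false : ∀ p → [ p ] + 1 ≡ 1 → p ≡ false
        first-false false _ = refl

      -- Any neighbour z of x is adjacent to w′, so `complementary` for z and w keeps w′ away from
      -- w.
      nonneighbours-independent : ∀ {w w′} → adj G x w ≡ false → adj G x w′ ≡ false →
        adj G w w′ ≡ false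
      nonneighbours-independent {w} {w′} x≁w x≁w′ with w Fin.≟ x
      ... | yes refl = x≁w′
      ... | no  w≢x  = second-false (adj G w w′)
        (subst (λ q → [ q ] + [ adj G w w′ ] ≡ 1) (cross x~z x≁w′) (complementary x~z w≢x x≁w w′))
        where
        x~z = proj₂ (count-positive (adj G x) 0<dx)
        second-false : ∀ p → 1 + [ p ] ≡ 1 → p ≡ false
        second-false false _ = refl

      bipartite : ∀ i j → adj G i j ≡ not (adj G x i) xor not (adj G x j)
      bipartite i j with adj G x i in x~i | adj G x j in x~j
      ... | true  | true  = neighbours-independent x~i x~j
      ... | true  | false = cross x~i x~j
      ... | false | true  = adj-sym (cross x~j x~i)
      ... | false | false = nonneighbours-independent x~i x~j

      -- The non-neighbours of x, x included, become the initial segment of length `co-d x`.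
      iso : G ≅ completeBipartite m (co-d x)
      iso with sorting (not ∘ adj G x)
      ... | π , sorted = ↔⇒⤖ π , λ i j → trans (bipartite i j) (cong₂ _xor_ (sorted i) (sorted j))

  -- Case distinction on the maximum degree

  -- The numbers d x and co-d x add up to 2n, so they lie equally far from n; n < d x makes the
  -- subtraction exact.
  half-order : ∀ {n x} → m ≡ n + n → n < d x → n ≡ co-d x + suc (d x ∸ suc n)
  half-order {n} {x} m≡2n n<dx = +-cancelˡ-≡ n n _ (begin
    n + n                     ≡⟨ m≡2n ⟨
    m                         ≡⟨ count-compl (adj G x) ⟨
    d x + co-d x              ≡⟨ cong (_+ co-d x) (trans (+-suc n p) (m+[n∸m]≡n n<dx)) ⟨
    n + suc p + co-d x        ≡⟨ +-assoc n (suc p) (co-d x) ⟩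
    n + (suc p + co-d x)      ≡⟨ cong (n +_) (+-comm (suc p) (co-d x)) ⟩
    n + (co-d x + suc p)      ∎)
    where
    open ≡-Reasoning
    p = d x ∸ suc n

  extremal : ∀ {n} → m ≡ n + n → 7 ≤ n → n * n + n * n ≤ sumFin m d + 2 →
    ∀ x → (∀ v → d v ≤ d x) → G ≅ completeBipartite m (n ∸ 1)
  extremal {n} m≡2n 7≤n dense x d≤dx with <-cmp (d x) n
  -- The degree sum is at most 2n(n - 1), which with the density hypothesis gives 2n ≤ 2.
  ... | tri< dx<n _ _ = ⊥-elim (1+n≰n (≤-trans (≤-trans (s≤s (s≤s (s≤s z≤n))) (≤-trans 7≤n (m≤m+n n n)))
    (+-cancelˡ-≤ (sumFin m d) (n + n) 2 (begin
      sumFin m d + (n + n)       ≤⟨ +-monoˡ-≤ (n + n) (sum-mono d≤dx) ⟩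
      sumFin m (λ _ → d x) + (n + n) ≡⟨ cong (_+ (n + n)) (trans (sum-const m (d x)) (cong (_* d x) m≡2n)) ⟩
      (n + n) * d x + (n + n)    ≡⟨ rearrange n (d x) ⟩
      (n + n) * suc (d x)        ≤⟨ *-monoʳ-≤ (n + n) dx<n ⟩
      (n + n) * n                ≡⟨ *-distribʳ-+ n n n ⟩
      n * n + n * n              ≤⟨ dense ⟩
      sumFin m d + 2             ∎))))
    where
    open ≤-Reasoning
    rearrange : ∀ n c → (n + n) * c + (n + n) ≡ (n + n) * suc c
    rearrange = solve-∀
  ... | tri≈ _ dx≡n _ = ⊥-elim (NearRegular.impossible m≡2n (≤-trans (m≤m+n 5 2) 7≤n)
    (λ v → ≤-trans (d≤dx v) (≤-reflexive dx≡n)) dense dx≡n)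
  -- x is its own non-neighbour, so the search excludes it explicitly.
  ... | tri> _ _ n<dx with any? (λ v → ¬? (v Fin.≟ x) ×-dec (adj G x v Bool.≟ false) ×-dec (d v ≟ d x))
  ... | no none = ⊥-elim (excess-impossible 7≤n dense (λ v v≢x x≁v dv≡dx → none (v , v≢x , x≁v , dv≡dx))
                    excess-bound)
    where
    open Excess m≡2n (half-order m≡2n n<dx) refl d≤dx
    excess-bound : sumFin m excess ≤ (1 + (d x ∸ suc n)) * (1 + ((d x ∸ suc n) + (d x ∸ suc n))) + 3
    excess-bound with any? (λ y → (adj G x y Bool.≟ true) ×-dec (d y ≟ d x))
    ... | yes (y , x~y , dy≡dx) = excess-adjacent-max x~y dy≡dx
    ... | no  none′ = excess-unique-max λ y x~y dy≡dx → none′ (y , x~y , dy≡dx)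
  ... | yes (v , v≢x , x≁v , dv≡dx) =
    subst (λ a → G ≅ completeBipartite m a) (≡-sym n∸1≡k) (Tight.iso tight (≤-trans (s≤s z≤n) n<dx))
    where
    open NonadjacentMax v≢x x≁v dv≡dx d≤dx
    k = co-d x
    p = d x ∸ suc n
    n≡ : n ≡ k + suc p
    n≡ = half-order m≡2n n<dx
    dx≡ : d x ≡ k + (suc p + suc p)
    dx≡ = Excess.dx≡ m≡2n n≡ refl d≤dx
    -- The difference is 2(p + 1)², because k = n - (p + 1) and d x = n + (p + 1).
    square-deficit : n * n + n * n ≡ sumFin m profile + (2 + (4 * p + 2 * p * p))
    square-deficit = begin
      n * n + n * n                                          ≡⟨ cong (λ c → c * c + c * c) n≡ ⟩
      (k + suc p) * (k + suc p) + (k + suc p) * (k + suc p)  ≡⟨ expand k p ⟩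
      k * (k + (suc p + suc p)) + (k + (suc p + suc p)) * k + (2 + (4 * p + 2 * p * p))
        ≡⟨ cong (λ c → k * c + c * k + (2 + (4 * p + 2 * p * p))) dx≡ ⟨
      k * d x + d x * k + (2 + (4 * p + 2 * p * p))
        ≡⟨ cong (_+ (2 + (4 * p + 2 * p * p))) sum-profile ⟨
      sumFin m profile + (2 + (4 * p + 2 * p * p))           ∎
      where
      open ≡-Reasoning
      expand : ∀ k p → (k + suc p) * (k + suc p) + (k + suc p) * (k + suc p) ≡
        k * (k + (suc p + suc p)) + (k + (suc p + suc p)) * k + (2 + (4 * p + 2 * p * p))
      expand = solve-∀
    dense′ : sumFin m profile + (2 + (4 * p + 2 * p * p)) ≤ sumFin m d + 2
    dense′ = subst (_≤ sumFin m d + 2) square-deficit dense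
    -- Density leaves room for a difference of at most 2, so 2(p + 1)² ≤ 2.
    p≡0 : p ≡ 0
    p≡0 = m+n≡0⇒m≡0 p (m+n≡0⇒m≡0 (4 * p) (n≤0⇒n≡0 (+-cancelˡ-≤ 2 _ 0
      (+-cancelˡ-≤ (sumFin m profile) _ 2 (≤-trans dense′ (+-monoˡ-≤ 2 (sum-mono d≤profile)))))))
    tight : sumFin m profile ≤ sumFin m d
    tight = +-cancelʳ-≤ 2 _ _ (≤-trans (+-monoʳ-≤ (sumFin m profile) (m≤m+n 2 _)) dense′)
    n∸1≡k : n ∸ 1 ≡ k
    n∸1≡k = cong (_∸ 1) (trans n≡ (trans (cong (λ c → k + suc c) p≡0) (+-comm k 1)))

theorem1p3 : Σ ℕ λ n₀ → 0 < n₀ × (∀ n → n₀ ≤ n →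
    ( (n * n ∸ 1 ≤ edgeCount (completeBipartite (n + n) (n ∸ 1))
    × NoEqualDegreeP3 (completeBipartite (n + n) (n ∸ 1)))
    × (∀ (G : Graph (n + n)) → n * n ∸ 1 ≤ edgeCount G → NoEqualDegreeP3 G
    → G ≅ completeBipartite (n + n) (n ∸ 1))))
-- The threshold 7 comes from `excess-impossible`. With n = `suc a` the parts have sizes a and a +
-- 2, and n² - 1 computes to `a + a * suc a`.
theorem1p3 = 7 , z<s , λ where
    (suc a) 7≤n →
      ( *-cancelˡ-≤ 2 (≤-reflexive (trans (double-product a)
          (trans (≡-sym (completeBipartite-edgeCount {a = a} {suc (suc a)} (parts a)))
                 (cong (edgeCount (completeBipartite (suc a + suc a) a) +_) (≡-sym (+-identityʳ _))))))
      , completeBipartite-noEqualDegreeP3 (parts a) (<⇒≢ (m<n⇒m<1+n (n<1+n a))) )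
      , λ G dense free →
          let x , d≤dx = maximum (degree G)
          in EqualDegreeP3Free.extremal G free refl 7≤n (degree-sum a G dense) x d≤dx
  where
  parts : ∀ a → a + suc (suc a) ≡ suc a + suc a
  parts a = +-suc a (suc a)
  double-product : ∀ a → 2 * (a + a * suc a) ≡ suc (suc a) * a + a * suc (suc a)
  double-product = solve-∀
  degree-sum : ∀ a (G : Graph (suc a + suc a)) → a + a * suc a ≤ edgeCount G →
    suc a * suc a + suc a * suc a ≤ sumFin _ (degree G) + 2
  degree-sum a G dense = begin
    suc a * suc a + suc a * suc a                 ≡⟨ expand a ⟩
    (a + a * suc a) + (a + a * suc a) + 2         ≤⟨ +-monoˡ-≤ 2 (+-mono-≤ dense dense) ⟩
    edgeCount G + edgeCount G + 2                 ≡⟨ cong (_+ 2) (handshake G) ⟩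
    sumFin _ (degree G) + 2                       ∎
    where
    open ≤-Reasoning
    expand : ∀ a → suc a * suc a + suc a * suc a ≡ (a + a * suc a) + (a + a * suc a) + 2
    expand = solve-∀
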